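{- Let $\ell\in\{1,2,3,4\}$. The game $K^\ell$ has no redundant move: for every single move $m\in\{(i,0),(0,i),(i,i): i\ge 1\}$, removing $m$ from the rule-set changes the set of $\mathcal{P}$-positions.
   Context: Positions are pairs $(x,y)\in\mathbb{N}^2$. The rule-set of Wythoff moves is $\{(i,0),(0,i),(i,i): i\ge1\}$; playing move $(u,v)$ from $(x,y)$ leads to $(x-u,y-v)$, provided both coordinates remain nonnegative. For $\ell\in\mathbb{N}$, $K^\ell$ is the two-player impartial game with these moves in which the positions of $\{(x,y):x+y\le\ell\}$ are terminal: no move is allowed from a terminal position, and a player who moves into a terminal position wins (normal play). A $\mathcal{P}$-position is a position from which the previous player has a winning strategy. A move is redundant if removing it from the rule-set (keeping everything else, including the terminal set, unchanged) does not change the set of $\mathcal{P}$-positions. -}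

module Defs where

open import Data.Nat using (ℕ; zero; suc; _+_; _∸_; _≤_; _<_)
open import Data.Product using (_×_)
open import Relation.Binary.PropositionalEquality using (_≡_)
open import Relation.Nullary using (¬_)

RuleSet : Set₁
RuleSet = ℕ → ℕ → Set

data Wythoff : RuleSet where
  horiz : ∀ i → Wythoff (suc i) 0
  vert  : ∀ i → Wythoff 0 (suc i)
  diag  : ∀ i → Wythoff (suc i) (suc i)

WythoffWithout : ℕ → ℕ → RuleSet
WythoffWithout a b u v = Wythoff u v × ¬ (u ≡ a × v ≡ b)

-- The game K^ℓ with rule-set R: positions (x,y) with x + y ≤ ℓ are terminal;
-- from a non-terminal (x,y) one may play any move (u,v) ∈ R with u ≤ x, v ≤ y,
-- reaching (x ∸ u , y ∸ v).  Normal play: P- and N-positions defined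
-- inductively in the standard way (terminal positions are P-positions since
-- the player who moved into them won).
data IsP (R : RuleSet) (ℓ : ℕ) : ℕ → ℕ → Set
data IsN (R : RuleSet) (ℓ : ℕ) : ℕ → ℕ → Set

data IsP R ℓ where
  terminal : ∀ {x y} → x + y ≤ ℓ → IsP R ℓ x y
  allN     : ∀ {x y} → ℓ < x + y →
             (∀ u v → R u v → u ≤ x → v ≤ y → IsN R ℓ (x ∸ u) (y ∸ v)) →
             IsP R ℓ x y

data IsN R ℓ where
  someP : ∀ {x y} u v → ℓ < x + y → R u v → u ≤ x → v ≤ y →
          IsP R ℓ (x ∸ u) (y ∸ v) → IsN R ℓ x y

{-# OPTIONS --safe #-}
-- The P-positions of K^ℓ beyond the terminal ones are (x , y) and (y , x),
-- where x carries the letter A and y is its partner in an infinite word W over {A , B} placed at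
-- the coordinates ℓ+1, ℓ+2, … : every A at x has a B as its partner, and W
-- satisfies W = A^(ℓ+1) σ(W) with σ(A) = BA, σ(B) = A.  Putting ℓ+1 dummy
-- letters T in front, with σ(T) = A, the word is produced by a queue from which
-- the letter at x is popped while its image under σ is appended; the partner of
-- x is then x plus the length of the queue.
--
-- A move is essential once it is the only winning move of some position.  The
-- move (i , 0) is so for (2(ℓ+1)+i , ℓ+1).  The move (i , i) is so for
-- (a+i , b+i) when b is the partner of a and W has an A at a, a+i and b+i.
-- Such an a exists for every i because W contains arbitrarily long stretches
-- around a and around its partner that read BAc and ABc with a common c.
module Submission where

open import Defs
open import Data.Empty using (⊥; ⊥-elim)
open import Data.List.Base using (List; []; _∷_; _++_; length; replicate; concatMap)
open import Data.List.Properties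
  using (++-assoc; ++-identityʳ; length-++; length-replicate; concatMap-++)
open import Data.Nat using (ℕ; zero; suc; _+_; _∸_; _≤_; _<_; z≤n; s≤s; s≤s⁻¹; _≟_; _≤?_)
open import Data.Nat.Induction using (<-rec)
open import Data.Nat.Properties
open import Data.Product using (∃-syntax; _×_; _,_; proj₁; proj₂)
open import Data.Sum using (_⊎_; inj₁; inj₂; [_,_]′)
open import Function using (_∘_)
open import Function.Bundles using (_⇔_; Equivalence)
open import Relation.Binary.Definitions using (tri<; tri≈; tri>)
open import Relation.Binary.PropositionalEquality
open import Relation.Nullary using (¬_; Dec; yes; no; contradiction)
open import Relation.Nullary.Decidable using (_×-dec_; ¬?)

-- The substitution σ and its action after BA and AB.

data Letter : Set where
  T A B : Letter

Word : Set
Word = List Letter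

σ₁ : Letter → Word
σ₁ T = A ∷ []
σ₁ A = B ∷ A ∷ []
σ₁ B = A ∷ []

σ : Word → Word
σ = concatMap σ₁

σ-++ : ∀ xs ys → σ (xs ++ ys) ≡ σ xs ++ σ ys
σ-++ = concatMap-++ σ₁

-- Chosen so that σ(BAc) = AB κ(c) and σ(ABc) = BA κ(c): σ exchanges BA and AB and acts by `κ` on a
-- common continuation.
κ : Word → Word
κ c = A ∷ σ c

-- Concatenations of the blocks A and AB, so that of two consecutive indices at least one carries an
-- A.
data Spaced : Word → Set where
  []  : Spaced []
  A∷  : ∀ {c} → Spaced c → Spaced (A ∷ c)
  AB∷ : ∀ {c} → Spaced c → Spaced (A ∷ B ∷ c)

-- Block by block, κ(Ac) = AB κ(c) and κ(ABc) = AB A κ(c).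
κ-spaced : ∀ {c} → Spaced c → Spaced (κ c)
κ-spaced []      = A∷ []
κ-spaced (A∷ s)  = AB∷ (κ-spaced s)
κ-spaced (AB∷ s) = AB∷ (A∷ (κ-spaced s))

κ-length : ∀ c → length c < length (κ c)
κ-length []      = s≤s z≤n
κ-length (T ∷ c) = s≤s (κ-length c)
κ-length (A ∷ c) = s≤s (≤-trans (κ-length c) (n≤1+n _))
κ-length (B ∷ c) = s≤s (κ-length c)

infix 4 _⊑_
_⊑_ : Word → Word → Set
c ⊑ c′ = ∃[ t ] c′ ≡ c ++ t

κ-⊑ : ∀ {c c′} → c ⊑ c′ → κ c ⊑ κ c′
κ-⊑ {c} (t , eq) = σ t , cong (A ∷_) (trans (cong σ eq) (σ-++ c t))

spaced-A : ∀ {c} → Spaced c → ∀ j → j < length c →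
  ∃[ u ] ∃[ v ] c ≡ u ++ A ∷ v × (length u ≡ j ⊎ suc (length u) ≡ j)
spaced-A (A∷ s) zero _ = [] , _ , refl , inj₁ refl
spaced-A (A∷ s) (suc j) (s≤s lt) =
  let u , v , eq , l = spaced-A s j lt
  in A ∷ u , v , cong (A ∷_) eq , [ inj₁ ∘ cong suc , inj₂ ∘ cong suc ]′ l
spaced-A (AB∷ s) zero _ = [] , _ , refl , inj₁ refl
spaced-A (AB∷ s) (suc zero) _ = [] , _ , refl , inj₂ refl
spaced-A (AB∷ s) (suc (suc j)) (s≤s (s≤s lt)) =
  let u , v , eq , l = spaced-A s j lt
  in A ∷ B ∷ u , v , cong (λ w → A ∷ B ∷ w) eq ,
     [ inj₁ ∘ cong (suc ∘ suc) , inj₂ ∘ cong (suc ∘ suc) ]′ l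

-- The word as a queue; gaps and partners.

module _ (ℓ : ℕ) where

  step : Word → Word
  step []      = []
  step (a ∷ q) = q ++ σ₁ a

  queue : ℕ → Word
  queue zero    = replicate (suc ℓ) T
  queue (suc n) = step (queue n)

  gap : ℕ → ℕ
  gap n = length (queue n)

  partner : ℕ → ℕ
  partner n = gap n + n

  data At (a : Letter) (n : ℕ) : Set where
    at : ∀ {q} → queue n ≡ a ∷ q → At a n

  advance : ∀ xs {ys} n → queue n ≡ xs ++ ys → queue (length xs + n) ≡ ys ++ σ xs
  advance []       {ys} n eq = trans eq (sym (++-identityʳ ys))
  advance (x ∷ xs) {ys} n eq = begin
    queue (suc (length xs + n))  ≡⟨ cong queue (+-suc (length xs) n) ⟨
    queue (length xs + suc n)    ≡⟨ advance xs (suc n) (trans (cong step eq) (++-assoc xs ys (σ₁ x))) ⟩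
    (ys ++ σ₁ x) ++ σ xs         ≡⟨ ++-assoc ys (σ₁ x) (σ xs) ⟩
    ys ++ σ₁ x ++ σ xs           ∎
    where open ≡-Reasoning

  at-offset : ∀ {a} xs {ys} n → queue n ≡ xs ++ a ∷ ys → At a (length xs + n)
  at-offset xs n eq = at (advance xs n eq)

  -- Between `n` and `partner n` exactly the letters queued at `n` are popped, which leaves only
  -- their images. The image of the letter at `n` therefore starts at `partner n`.
  queue-partner : ∀ n → queue (partner n) ≡ σ (queue n)
  queue-partner n = advance (queue n) n (sym (++-identityʳ (queue n)))

  -- A pop removes one letter, which the `suc` accounts for, and appends an image. So the gap grows
  -- by one at an A and is constant at T and B.
  gap-suc : ∀ {a} n → At a n → suc (gap (suc n)) ≡ length (σ₁ a) + gap n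
  gap-suc {a} n (at {q} eq) = begin
    suc (length (step (queue n)))    ≡⟨ cong (suc ∘ length ∘ step) eq ⟩
    suc (length (q ++ σ₁ a))         ≡⟨ cong suc (length-++ q) ⟩
    suc (length q + length (σ₁ a))   ≡⟨ +-comm (suc (length q)) (length (σ₁ a)) ⟩
    length (σ₁ a) + length (a ∷ q)   ≡⟨ cong (λ w → length (σ₁ a) + length w) eq ⟨
    length (σ₁ a) + gap n            ∎
    where open ≡-Reasoning

  gap-T : ∀ n → At T n → gap (suc n) ≡ gap n
  gap-T n a = suc-injective (gap-suc n a)

  gap-A : ∀ n → At A n → gap (suc n) ≡ suc (gap n)
  gap-A n a = suc-injective (gap-suc n a)

  gap-B : ∀ n → At B n → gap (suc n) ≡ gap n
  gap-B n a = suc-injective (gap-suc n a)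

  step-length : ∀ w → length w ≤ length (step w)
  step-length []      = z≤n
  step-length (a ∷ q) = begin
    suc (length q)               ≤⟨ +-monoˡ-≤ (length q) (image a) ⟩
    length (σ₁ a) + length q     ≡⟨ +-comm (length (σ₁ a)) (length q) ⟩
    length q + length (σ₁ a)     ≡⟨ length-++ q ⟨
    length (q ++ σ₁ a)           ∎
    where
    open ≤-Reasoning
    image : ∀ a → 1 ≤ length (σ₁ a)
    image T = s≤s z≤n
    image A = s≤s z≤n
    image B = s≤s z≤n

  gap-mono-+ : ∀ k n → gap n ≤ gap (k + n)
  gap-mono-+ zero    n = ≤-refl
  gap-mono-+ (suc k) n = ≤-trans (gap-mono-+ k n) (step-length (queue (k + n)))

  gap-mono : ∀ {m n} → m ≤ n → gap m ≤ gap n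
  gap-mono {m} {n} m≤n =
    subst (λ k → gap m ≤ gap k) (m∸n+n≡m m≤n) (gap-mono-+ (n ∸ m) m)

  gap-zero : gap 0 ≡ suc ℓ
  gap-zero = length-replicate (suc ℓ)

  ℓ<gap : ∀ n → ℓ < gap n
  ℓ<gap n = subst (_≤ gap n) gap-zero (gap-mono {0} {n} z≤n)

  gap-strict : ∀ {m n} → At A m → m < n → gap m < gap n
  gap-strict {m} {n} am m<n = subst (_≤ gap n) (gap-A m am) (gap-mono m<n)

  gap-injective : ∀ {m n} → At A m → At A n → gap m ≡ gap n → m ≡ n
  gap-injective {m} {n} am an eq with <-cmp m n
  ... | tri< lt _ _ = contradiction eq (<⇒≢ (gap-strict am lt))
  ... | tri≈ _ e _  = e
  ... | tri> _ _ gt = contradiction (sym eq) (<⇒≢ (gap-strict an gt))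

  partner-strict : ∀ {m n} → m < n → partner m < partner n
  partner-strict m<n = +-mono-≤-< (gap-mono (<⇒≤ m<n)) m<n

  partner-injective : ∀ {m n} → partner m ≡ partner n → m ≡ n
  partner-injective {m} {n} eq with <-cmp m n
  ... | tri< lt _ _ = contradiction eq (<⇒≢ (partner-strict lt))
  ... | tri≈ _ e _  = e
  ... | tri> _ _ gt = contradiction (sym eq) (<⇒≢ (partner-strict gt))

  letter : ∀ n → At T n ⊎ At A n ⊎ At B n
  letter n with queue n in eq | ℓ<gap n
  ... | T ∷ q | _ = inj₁ (at eq)
  ... | A ∷ q | _ = inj₂ (inj₁ (at eq))
  ... | B ∷ q | _ = inj₂ (inj₂ (at eq))

  A≢B : ∀ {n} → At A n → At B n → ⊥
  A≢B (at p) (at q) with () ← trans (sym p) q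

  T≢A : ∀ {n} → At T n → At A n → ⊥
  T≢A (at p) (at q) with () ← trans (sym p) q

  T≢B : ∀ {n} → At T n → At B n → ⊥
  T≢B (at p) (at q) with () ← trans (sym p) q

  partner-T : ∀ {n} → At T n → At A (partner n)
  partner-T {n} (at eq) = at (trans (queue-partner n) (cong σ eq))

  partner-A : ∀ {n} → At A n → At B (partner n)
  partner-A {n} (at eq) = at (trans (queue-partner n) (cong σ eq))

  partner-A-suc : ∀ {n} → At A n → At A (suc (partner n))
  partner-A-suc {n} (at eq) = at (cong step (trans (queue-partner n) (cong σ eq)))

  partner-B : ∀ {n} → At B n → At A (partner n)
  partner-B {n} (at eq) = at (trans (queue-partner n) (cong σ eq))

  replicate-T : ∀ {n} k → replicate (n + suc k) T ≡ replicate n T ++ T ∷ replicate k T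
  replicate-T {zero}  k = refl
  replicate-T {suc n} k = cong (T ∷_) (replicate-T k)

  initial-T : ∀ {n} → n ≤ ℓ → At T n
  initial-T {n} n≤ℓ = subst (At T) pos (at-offset (replicate n T) 0 split)
    where
    pos : length (replicate n T) + 0 ≡ n
    pos = trans (+-identityʳ _) (length-replicate n)
    split : queue 0 ≡ replicate n T ++ T ∷ replicate (ℓ ∸ n) T
    split = trans (cong (λ k → replicate k T)
                    (sym (trans (+-suc n (ℓ ∸ n)) (cong suc (m+[n∸m]≡n n≤ℓ)))))
                  (replicate-T (ℓ ∸ n))

  A⇒ℓ< : ∀ {n} → At A n → ℓ < n
  A⇒ℓ< an = ≰⇒> λ n≤ℓ → T≢A (initial-T n≤ℓ) an

  -- Every letter as part of an image.

  data Origin (n : ℕ) : Set where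
    initial : n ≤ ℓ → Origin n
    first   : ∀ m → n ≡ partner m → Origin n
    second  : ∀ m → At A m → n ≡ suc (partner m) → Origin n

  -- `partner (suc m)` exceeds `partner m` by the length of the image of the letter at `m`, so the
  -- images tile everything from `partner 0`, which is ℓ+1, onwards. Only σ(A) = BA has a second
  -- letter.
  origin : ∀ n → Origin n
  origin zero = initial z≤n
  origin (suc n) with origin n
  ... | initial n≤ℓ with suc n ≤? ℓ
  ...   | yes le = initial le
  ...   | no nle = first 0 (begin
    suc n      ≡⟨ ≤-antisym (s≤s n≤ℓ) (≰⇒> nle) ⟩
    suc ℓ      ≡⟨ gap-zero ⟨
    gap 0      ≡⟨ +-identityʳ (gap 0) ⟨
    partner 0  ∎)
    where open ≡-Reasoning
  origin (suc n) | first m refl with letter m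
  ... | inj₁ t        = first (suc m) (trans (sym (+-suc (gap m) m)) (cong (_+ suc m) (sym (gap-T m t))))
  ... | inj₂ (inj₁ a) = second m a refl
  ... | inj₂ (inj₂ b) = first (suc m) (trans (sym (+-suc (gap m) m)) (cong (_+ suc m) (sym (gap-B m b))))
  origin (suc n) | second m a refl =
    first (suc m) (trans (cong suc (sym (+-suc (gap m) m))) (cong (_+ suc m) (sym (gap-A m a))))

  T⇒≤ℓ : ∀ {n} → At T n → n ≤ ℓ
  T⇒≤ℓ {n} t with origin n
  ... | initial le = le
  ... | second m a refl = ⊥-elim (T≢A t (partner-A-suc a))
  ... | first m refl with letter m
  ...   | inj₁ tm        = ⊥-elim (T≢A t (partner-T tm))
  ...   | inj₂ (inj₁ am) = ⊥-elim (T≢B t (partner-A am))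
  ...   | inj₂ (inj₂ bm) = ⊥-elim (T≢A t (partner-B bm))

  B⇒partner : ∀ {n} → At B n → ∃[ m ] At A m × n ≡ partner m
  B⇒partner {n} b with origin n
  ... | initial le = ⊥-elim (T≢B (initial-T le) b)
  ... | second m a refl = ⊥-elim (A≢B (partner-A-suc a) b)
  ... | first m refl with letter m
  ...   | inj₁ tm        = ⊥-elim (A≢B (partner-T tm) b)
  ...   | inj₂ (inj₁ am) = m , am , refl
  ...   | inj₂ (inj₂ bm) = ⊥-elim (A≢B (partner-B bm) b)

  -- Gaps start at ℓ+1 and rise by one exactly on passing an A, so no value is skipped. The bound
  -- `m < n` leaves room for a diagonal move.
  gap-surjective : ∀ {δ} n → ℓ < δ → δ < gap n → ∃[ m ] m < n × At A m × gap m ≡ δ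
  gap-surjective {δ} zero ℓ<δ δ<gap = contradiction (subst (δ <_) gap-zero δ<gap) (≤⇒≯ ℓ<δ)
  gap-surjective {δ} (suc n) ℓ<δ δ<gap with letter n
  ... | inj₁ t =
    let m , m<n , rest = gap-surjective n ℓ<δ (subst (δ <_) (gap-T n t) δ<gap)
    in m , m<n⇒m<1+n m<n , rest
  ... | inj₂ (inj₂ b) =
    let m , m<n , rest = gap-surjective n ℓ<δ (subst (δ <_) (gap-B n b) δ<gap)
    in m , m<n⇒m<1+n m<n , rest
  ... | inj₂ (inj₁ a) with m<1+n⇒m<n∨m≡n (subst (δ <_) (gap-A n a) δ<gap)
  ...   | inj₂ eq = n , ≤-refl , a , sym eq
  ...   | inj₁ lt   =
    let m , m<n , rest = gap-surjective n ℓ<δ lt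
    in m , m<n⇒m<1+n m<n , rest

  -- Long stretches common to a place and its partner.

  record Stretch (i : ℕ) : Set where
    constructor stretch
    field
      n      : ℕ
      c r    : Word
      queue≡ : queue n ≡ B ∷ A ∷ c ++ r
      long   : i ≤ length c
      spaced : Spaced c
      -- At `partner n` the word reads AB followed by `κ c`, so this makes `c` readable there too.
      prefix : c ⊑ κ c

  σ-BA : ∀ c r → σ (B ∷ A ∷ c ++ r) ≡ A ∷ B ∷ κ c ++ σ r
  σ-BA c r = cong (λ w → A ∷ B ∷ A ∷ w) (σ-++ c r)

  σ-AB : ∀ c r → σ (A ∷ B ∷ c ++ r) ≡ B ∷ A ∷ κ c ++ σ r
  σ-AB c r = cong (λ w → B ∷ A ∷ A ∷ w) (σ-++ c r)

  queue-partner-BA : ∀ c r n → queue n ≡ B ∷ A ∷ c ++ r →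
    queue (partner n) ≡ A ∷ B ∷ κ c ++ σ r
  queue-partner-BA c r n eq = trans (queue-partner n) (trans (cong σ eq) (σ-BA c r))

  queue-partner-AB : ∀ c r n → queue n ≡ A ∷ B ∷ c ++ r →
    queue (partner n) ≡ B ∷ A ∷ κ c ++ σ r
  queue-partner-AB c r n eq = trans (queue-partner n) (trans (cong σ eq) (σ-AB c r))

  stretches : ∀ i → Stretch i
  stretches zero = record
    -- Two images turn the leading T into A and then into BA.
    { n = partner (partner 0) ; c = [] ; r = _ ; queue≡ = eq
    ; long = z≤n ; spaced = [] ; prefix = _ , refl }
    where
    eq : queue (partner (partner 0)) ≡ B ∷ A ∷ σ (σ (replicate ℓ T))
    eq = trans (queue-partner (partner 0)) (cong σ (queue-partner 0))
  stretches (suc i) with stretches i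
  ... | stretch n c r eq long spaced prefix = record
    -- Two images lead from BA through AB back to BA, and `κ` lengthens the continuation each time.
    { n = partner (partner n) ; c = κ (κ c) ; r = σ (σ r)
    ; queue≡ = queue-partner-AB (κ c) (σ r) (partner n) (queue-partner-BA c r n eq)
    ; long = ≤-trans (s≤s long) (≤-trans (κ-length c) (<⇒≤ (κ-length (κ c))))
    ; spaced = κ-spaced (κ-spaced spaced)
    ; prefix = κ-⊑ (κ-⊑ prefix) }

  at-prefix : ∀ {x y w} u {v} r n → w ≡ u ++ A ∷ v → queue n ≡ x ∷ y ∷ w ++ r →
    At A (2 + (length u + n))
  at-prefix {x} {y} u {v} r n refl eq =
    at-offset (x ∷ y ∷ u) n (trans eq (cong (λ w → x ∷ y ∷ w) (++-assoc u (A ∷ v) r)))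

  ⊑-split : ∀ {c c′ u v} → c ⊑ c′ → c ≡ u ++ A ∷ v → ∃[ t ] c′ ≡ u ++ A ∷ t
  ⊑-split {u = u} {v} (t , refl) refl = _ , ++-assoc u (A ∷ v) t

  -- The three places read BAc, ABc… and BAc…; an A at index i of c serves a
  -- pair taken at the second letter of the first two, an A at index i − 1 a
  -- pair taken at the first letter of the last two.
  diagonal-witness : ∀ i → ∃[ a ] At A a × At A (suc i + a) × At A (suc i + partner a)
  diagonal-witness i with stretches (suc i)
  ... | stretch n c r eq₀ long spaced prefix
    with spaced-A spaced i long
       | queue-partner-BA c r n eq₀
       | queue-partner-AB (κ c) (σ r) (partner n) (queue-partner-BA c r n eq₀)
  ... | u , v , c≡ , inj₁ refl | eq₁ | _ =
    suc n
    , at (cong step eq₀)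
    , subst (At A) (cong suc (sym (+-suc (length u) n))) (at-prefix u r n c≡ eq₀)
    , subst (At A) shift (at-prefix u (σ r) (partner n) (proj₂ (⊑-split prefix c≡)) eq₁)
    where
    open ≡-Reasoning
    shift : 2 + (length u + partner n) ≡ suc (length u) + partner (suc n)
    shift = cong suc (begin
      suc (length u + partner n)        ≡⟨ +-suc (length u) (partner n) ⟨
      length u + suc (gap n + n)        ≡⟨ cong (length u +_) (+-suc (gap n) n) ⟨
      length u + (gap n + suc n)        ≡⟨ cong (λ g → length u + (g + suc n)) (gap-B n (at eq₀)) ⟨
      length u + partner (suc n)        ∎)
  ... | u , v , c≡ , inj₂ refl | eq₁ | eq₂ =
    let _ , κc≡ = ⊑-split prefix c≡
    in partner n
     , at eq₁
     , at-prefix u (σ r) (partner n) κc≡ eq₁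
     , at-prefix u (σ (σ r)) (partner (partner n)) (proj₂ (⊑-split (κ-⊑ prefix) κc≡)) eq₂

  -- Cold positions: isolated from each other, reachable from all others.

  data Cold (x y : ℕ) : Set where
    terminal : x + y ≤ ℓ → Cold x y
    lower    : At A x → y ≡ partner x → Cold x y
    upper    : At A y → x ≡ partner y → Cold x y

  transpose : ∀ {u v} → Wythoff u v → Wythoff v u
  transpose (horiz i) = vert i
  transpose (vert i)  = horiz i
  transpose (diag i)  = diag i

  cold-sym : ∀ {x y} → Cold x y → Cold y x
  cold-sym {x} {y} (terminal le) = terminal (subst (_≤ ℓ) (+-comm x y) le)
  cold-sym (lower a eq) = upper a eq
  cold-sym (upper a eq) = lower a eq

  suc+⇒< : ∀ {k p x} → suc k + p ≡ x → p < x
  suc+⇒< {k} {p} eq = subst (p <_) eq (m<n+m p (s≤s z≤n))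

  n<partner : ∀ n → n < partner n
  n<partner n = m<n+m n (≤-trans (s≤s z≤n) (ℓ<gap n))

  ℓ<partner : ∀ n → ℓ < partner n
  ℓ<partner n = ≤-trans (ℓ<gap n) (m≤m+n (gap n) n)

  -- The difference exceeds ℓ, which excludes `terminal`, and its sign excludes `upper`; on the
  -- letters A the gap is injective.
  cold-on-diagonal : ∀ {n p q} → At A n → q ≡ gap n + p → Cold p q → p ≡ n
  cold-on-diagonal {n} {p} _ refl (terminal le) =
    contradiction (≤-trans (m≤m+n (gap n) p) (≤-trans (m≤n+m _ p) le)) (<⇒≱ (ℓ<gap n))
  cold-on-diagonal {n} {p} an refl (lower ap eq) =
    gap-injective ap an (sym (+-cancelʳ-≡ p (gap n) (gap p) eq))
  cold-on-diagonal {n} {p} an refl (upper aq eq) =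
    contradiction eq (<⇒≢ (≤-<-trans (m≤n+m p (gap n)) (n<partner (gap n + p))))

  -- The offset `u` serves both a cold position (`u` = 0) and its translate along the diagonal.
  diagonal-difference : ∀ {u n p q x y} d → u + n ≡ x → u + (d + n) ≡ y →
    ∀ {k} → suc k + p ≡ x → suc k + q ≡ y → q ≡ d + p
  diagonal-difference {u} {n} {p} {q} d refl refl {k} ep eq = +-cancelˡ-≡ (suc k) _ _ (begin
    suc k + q       ≡⟨ eq ⟩
    u + (d + n)     ≡⟨ shift u n ⟩
    d + (u + n)     ≡⟨ cong (d +_) ep ⟨
    d + (suc k + p) ≡⟨ shift (suc k) p ⟨
    suc k + (d + p) ∎)
    where
    open ≡-Reasoning
    shift : ∀ a b → a + (d + b) ≡ d + (a + b)
    shift a b = trans (sym (+-assoc a d b)) (trans (cong (_+ b) (+-comm a d)) (+-assoc d a b))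

  -- Along a row or column the letter of the fixed coordinate, A for the smaller and B for the
  -- larger, forces the orientation; `partner`, being injective, then forces the other coordinate.
  -- Along a diagonal the gap decides.
  lower-isolated : ∀ {x u v p q} → At A x → Wythoff u v →
    u + p ≡ x → v + q ≡ partner x → Cold p q → ⊥
  lower-isolated {x} {p = p} ax (horiz i) ep refl (terminal le) =
    contradiction (≤-trans (m≤n+m (partner x) p) le) (<⇒≱ (ℓ<partner x))
  lower-isolated {x} {p = p} ax (horiz i) ep refl (lower _ eq) =
    <⇒≢ (suc+⇒< ep) (sym (partner-injective {x} {p} eq))
  lower-isolated ax (horiz i) ep refl (upper aq _) = A≢B aq (partner-A ax)
  lower-isolated ax (vert i) refl eq (terminal le) =
    contradiction (≤-trans (m≤m+n _ _) le) (<⇒≱ (A⇒ℓ< ax))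
  lower-isolated ax (vert i) refl eq (lower _ q≡) = <⇒≢ (suc+⇒< eq) q≡
  lower-isolated ax (vert i) refl eq (upper aq refl) = A≢B ax (partner-A aq)
  lower-isolated {x} ax (diag i) ep eq c =
    <⇒≢ (suc+⇒< ep) (cold-on-diagonal ax (diagonal-difference {0} (gap x) refl refl ep eq) c)

  cold-isolated : ∀ {x y u v p q} → ℓ < x + y → Cold x y → Wythoff u v →
    u + p ≡ x → v + q ≡ y → Cold p q → ⊥
  cold-isolated ℓ< (terminal le) _ _ _ _ = <⇒≱ ℓ< le
  cold-isolated _ (lower ax refl) w ep eq c = lower-isolated ax w ep eq c
  cold-isolated _ (upper ax refl) w ep eq c = lower-isolated ax (transpose w) eq ep (cold-sym c)

  record Reaches (x y : ℕ) : Set where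
    constructor reaches
    field
      {u v p q} : ℕ
      move      : Wythoff u v
      x≡        : u + p ≡ x
      y≡        : v + q ≡ y
      cold      : Cold p q

  reaches-sym : ∀ {x y} → Reaches x y → Reaches y x
  reaches-sym (reaches w ep eq c) = reaches (transpose w) eq ep (cold-sym c)

  <⇒suc+ : ∀ {q y} → q < y → ∃[ k ] suc k + q ≡ y
  <⇒suc+ {q} q<y = let k , eq = m≤n⇒∃[o]m+o≡n q<y in k , trans (cong suc (+-comm k q)) eq

  vertically : ∀ {x y q} → q < y → Cold x q → Reaches x y
  vertically q<y c = let k , eq = <⇒suc+ q<y in reaches (vert k) refl eq c

  diagonally : ∀ {x p δ} → p < x → Cold p (δ + p) → Reaches x (δ + x)
  diagonally {x} {p} {δ} p<x c = let k , eq = <⇒suc+ p<x in reaches (diag k) eq (lift k eq) c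
    where
    open ≡-Reasoning
    lift : ∀ k → suc k + p ≡ x → suc k + (δ + p) ≡ δ + x
    lift k refl = begin
      suc k + (δ + p) ≡⟨ +-assoc (suc k) δ p ⟨
      suc k + δ + p   ≡⟨ cong (_+ p) (+-comm (suc k) δ) ⟩
      δ + suc k + p   ≡⟨ +-assoc δ (suc k) p ⟩
      δ + (suc k + p) ∎

  -- The letter at the smaller coordinate `x` chooses the move. A T drops to (x , 0), a B to the A
  -- whose partner it is. An A drops to its own partner if δ is above `gap x`; if δ is below, it
  -- follows the diagonal, to (0 , δ) for δ ≤ ℓ and otherwise to the A with gap δ.
  cold⊎reaches-≤ : ∀ x δ → Cold x (δ + x) ⊎ Reaches x (δ + x)
  cold⊎reaches-≤ x δ with letter x
  ... | inj₁ t with δ + x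
  ...   | zero  = inj₁ (terminal (≤-trans (≤-reflexive (+-identityʳ x)) (T⇒≤ℓ t)))
  ...   | suc y = inj₂ (vertically (s≤s z≤n)
                    (terminal (≤-trans (≤-reflexive (+-identityʳ x)) (T⇒≤ℓ t))))
  cold⊎reaches-≤ x δ | inj₂ (inj₂ b) with B⇒partner b
  ... | m , am , refl =
    inj₂ (vertically (<-≤-trans (n<partner m) (m≤n+m (partner m) δ)) (upper am refl))
  cold⊎reaches-≤ x δ | inj₂ (inj₁ a) with <-cmp δ (gap x)
  ... | tri≈ _ refl _ = inj₁ (lower a refl)
  ... | tri> _ _ gt   = inj₂ (vertically (+-monoˡ-< x gt) (lower a refl))
  ... | tri< lt _ _ with δ ≤? ℓ
  ...   | yes le = inj₂ (diagonally (≤-trans (s≤s z≤n) (A⇒ℓ< a))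
                     (terminal (≤-trans (≤-reflexive (+-identityʳ δ)) le)))
  ...   | no nle = let m , m<x , am , eq = gap-surjective x (≰⇒> nle) lt
                   in inj₂ (diagonally m<x (lower am (cong (_+ m) (sym eq))))

  cold⊎reaches : ∀ x y → Cold x y ⊎ Reaches x y
  cold⊎reaches x y with ≤-total x y
  ... | inj₁ le = subst (λ k → Cold x k ⊎ Reaches x k) (m∸n+n≡m le) (cold⊎reaches-≤ x (y ∸ x))
  ... | inj₂ le = subst (λ k → Cold k y ⊎ Reaches k y) (m∸n+n≡m le)
    ([ inj₁ ∘ cold-sym , inj₂ ∘ reaches-sym ]′ (cold⊎reaches-≤ y (x ∸ y)))

  -- The P-positions are the cold positions.

  P∧N⇒⊥ : ∀ {R x y} → IsP R ℓ x y → IsN R ℓ x y → ⊥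
  P∧N⇒⊥ (terminal le) (someP _ _ ℓ< _ _ _ _)   = <⇒≱ ℓ< le
  P∧N⇒⊥ (allN _ f)    (someP u v _ r u≤ v≤ p) = P∧N⇒⊥ p (f u v r u≤ v≤)

  reach-N : ∀ {x y u v p q} → ℓ < x + y → Wythoff u v → u + p ≡ x → v + q ≡ y →
    IsP Wythoff ℓ p q → IsN Wythoff ℓ x y
  reach-N {u = u} {v} {p} {q} ℓ< w refl refl P =
    someP u v ℓ< w (m≤m+n u p) (m≤m+n v q)
      (subst₂ (IsP Wythoff ℓ) (sym (m+n∸m≡n u p)) (sym (m+n∸m≡n v q)) P)

  move-decreases : ∀ {u v} p q → Wythoff u v → p + q < (u + p) + (v + q)
  move-decreases p q (horiz i) = +-monoˡ-< q (m<n+m p (s≤s z≤n))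
  move-decreases p q (vert i)  = +-monoʳ-< p (m<n+m q (s≤s z≤n))
  move-decreases p q (diag i)  = +-mono-< (m<n+m p (s≤s z≤n)) (m<n+m q (s≤s z≤n))

  option-smaller : ∀ {x y u v} → Wythoff u v → u ≤ x → v ≤ y → (x ∸ u) + (y ∸ v) < x + y
  option-smaller {x} {y} {u} {v} w u≤ v≤ =
    subst₂ (λ a b → (x ∸ u) + (y ∸ v) < a + b) (m+[n∸m]≡n u≤) (m+[n∸m]≡n v≤)
      (move-decreases (x ∸ u) (y ∸ v) w)

  option-reaches-smaller : ∀ {x y u v p q} → Wythoff u v → u + p ≡ x → v + q ≡ y → p + q < x + y
  option-reaches-smaller {p = p} {q} w refl refl = move-decreases p q w

  -- The induction on the coordinate sum is used two moves down: no option is cold, so each has an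
  -- answer leading to a smaller cold position.
  cold⇒P : ∀ {x y} → Cold x y → IsP Wythoff ℓ x y
  cold⇒P {x} {y} = <-rec (λ k → ∀ x y → x + y ≡ k → Cold x y → IsP Wythoff ℓ x y) go (x + y) x y refl
    where
    go : ∀ k → (∀ {j} → j < k → ∀ x y → x + y ≡ j → Cold x y → IsP Wythoff ℓ x y) →
         ∀ x y → x + y ≡ k → Cold x y → IsP Wythoff ℓ x y
    go _ rec x y refl c with x + y ≤? ℓ
    ... | yes le = terminal le
    ... | no nle = allN (≰⇒> nle) hot
      where
      hot : ∀ u v → Wythoff u v → u ≤ x → v ≤ y → IsN Wythoff ℓ (x ∸ u) (y ∸ v)
      -- `cold⊎reaches` may offer a move from a terminal position, where none is allowed; hence the
      -- separate test.
      hot u v w u≤ v≤ with (x ∸ u) + (y ∸ v) ≤? ℓ | cold⊎reaches (x ∸ u) (y ∸ v)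
      ... | yes le | _ = ⊥-elim (cold-isolated (≰⇒> nle) c w (m+[n∸m]≡n u≤) (m+[n∸m]≡n v≤) (terminal le))
      ... | no _ | inj₁ c′ = ⊥-elim (cold-isolated (≰⇒> nle) c w (m+[n∸m]≡n u≤) (m+[n∸m]≡n v≤) c′)
      ... | no nle′ | inj₂ (reaches w′ ep eq c′) =
        reach-N (≰⇒> nle′) w′ ep eq
          (rec (<-trans (option-reaches-smaller w′ ep eq) (option-smaller w u≤ v≤)) _ _ refl c′)

  P⇒cold : ∀ {x y} → IsP Wythoff ℓ x y → Cold x y
  P⇒cold {x} {y} P with x + y ≤? ℓ | cold⊎reaches x y
  ... | yes le | _      = terminal le
  ... | no _   | inj₁ c = c
  ... | no nle | inj₂ (reaches w ep eq c) = ⊥-elim (P∧N⇒⊥ P (reach-N (≰⇒> nle) w ep eq (cold⇒P c)))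

  -- Determinacy for a reduced rule-set.

  wythoff? : ∀ u v → Dec (Wythoff u v)
  wythoff? zero    zero    = no λ ()
  wythoff? zero    (suc v) = yes (vert v)
  wythoff? (suc u) zero    = yes (horiz u)
  wythoff? (suc u) (suc v) with u ≟ v
  ... | yes refl = yes (diag u)
  ... | no u≢v   = no λ { (diag _) → u≢v refl }

  without? : ∀ a b u v → Dec (WythoffWithout a b u v)
  without? a b u v = wythoff? u v ×-dec ¬? (u ≟ a ×-dec v ≟ b)

  module _ {R : RuleSet} (R? : ∀ u v → Dec (R u v)) (R⊆W : ∀ {u v} → R u v → Wythoff u v) where

    Determined : ℕ → ℕ → Set
    Determined x y = IsP R ℓ x y ⊎ IsN R ℓ x y

    determined-step : ∀ x y → ℓ < x + y →
      (∀ {u v} → R u v → u ≤ x → v ≤ y → Determined (x ∸ u) (y ∸ v)) → Determined x y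
    -- `anyUpTo?` searches strictly below its bound, hence `suc x` and `suc y`.
    determined-step x y ℓ< rec with anyUpTo? (λ u → anyUpTo? (winning? u) (suc y)) (suc x)
      where
      Winning : ℕ → ℕ → Set
      Winning u v = R u v × u ≤ x × v ≤ y × IsP R ℓ (x ∸ u) (y ∸ v)
      winning? : ∀ u v → Dec (Winning u v)
      -- `rec` speaks of legal moves only, so legality is settled before the option is examined.
      winning? u v with R? u v | u ≤? x | v ≤? y
      ... | no ¬r | _      | _      = no (¬r ∘ proj₁)
      ... | yes _ | no u≰  | _      = no (u≰ ∘ proj₁ ∘ proj₂)
      ... | yes _ | yes _  | no v≰  = no (v≰ ∘ proj₁ ∘ proj₂ ∘ proj₂)
      ... | yes r | yes u≤ | yes v≤ with rec r u≤ v≤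
      ...   | inj₁ P = yes (r , u≤ , v≤ , P)
      ...   | inj₂ N = no λ (_ , _ , _ , P) → P∧N⇒⊥ P N
    ... | yes (u , _ , v , _ , r , u≤ , v≤ , P) = inj₂ (someP u v ℓ< r u≤ v≤ P)
    ... | no none = inj₁ (allN ℓ< allOptionsN)
      where
      allOptionsN : ∀ u v → R u v → u ≤ x → v ≤ y → IsN R ℓ (x ∸ u) (y ∸ v)
      allOptionsN u v r u≤ v≤ with rec r u≤ v≤
      ... | inj₁ P = contradiction (u , s≤s u≤ , v , s≤s v≤ , r , u≤ , v≤ , P) none
      ... | inj₂ N = N

    -- No description of the P-positions is at hand for a reduced rule-set, so the alternative comes
    -- from a finite search; moves of `R` are Wythoff moves and lower the coordinate sum.
    determined : ∀ x y → Determined x y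
    determined x y = <-rec (λ k → ∀ x y → x + y ≡ k → Determined x y) go (x + y) x y refl
      where
      go : ∀ k → (∀ {j} → j < k → ∀ x y → x + y ≡ j → Determined x y) →
           ∀ x y → x + y ≡ k → Determined x y
      go _ rec x y refl with x + y ≤? ℓ
      ... | yes le = inj₁ (terminal le)
      ... | no nle = determined-step x y (≰⇒> nle)
              λ r u≤ v≤ → rec (option-smaller (R⊆W r) u≤ v≤) _ _ refl

  -- Positions with a single winning move.

  record UniqueWin (a b : ℕ) : Set where
    field
      -- The cold target; the position with the single winning move is (a + x , b + y).
      x y    : ℕ
      move   : Wythoff a b
      cold   : Cold x y
      ℓ<     : ℓ < (a + x) + (b + y)
      unique : ∀ {u v p q} → Wythoff u v → u + p ≡ a + x → v + q ≡ b + y → Cold p q → u ≡ a × v ≡ b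

  uniqueWin-sym : ∀ {a b} → UniqueWin a b → UniqueWin b a
  uniqueWin-sym {a} {b} win = record
    { x = y ; y = x ; move = transpose move ; cold = cold-sym cold
    ; ℓ< = subst (ℓ <_) (+-comm (a + x) (b + y)) ℓ<
    ; unique = λ w ep eq c → let u≡ , v≡ = unique (transpose w) eq ep (cold-sym c) in v≡ , u≡ }
    where open UniqueWin win

  -- If the P-positions agreed, no remaining option of (X , Y) would be cold, so by determinacy all
  -- would be N after the removal. Then (X , Y) would be P in both games, yet the full rules make it
  -- N.
  uniqueWin⇒essential : ∀ {a b} → UniqueWin a b →
    ¬ (∀ x y → IsP Wythoff ℓ x y ⇔ IsP (WythoffWithout a b) ℓ x y)
  uniqueWin⇒essential {a} {b} win same =
    P∧N⇒⊥ (Equivalence.from (same X Y) (allN ℓ< hot)) (reach-N ℓ< move refl refl (cold⇒P cold))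
    where
    open UniqueWin win
    X Y : ℕ
    X = a + x
    Y = b + y
    hot : ∀ u v → WythoffWithout a b u v → u ≤ X → v ≤ Y →
          IsN (WythoffWithout a b) ℓ (X ∸ u) (Y ∸ v)
    hot u v (w , ≢m) u≤ v≤ with determined (without? a b) proj₁ (X ∸ u) (Y ∸ v)
    ... | inj₂ N = N
    ... | inj₁ P = contradiction
      (unique w (m+[n∸m]≡n u≤) (m+[n∸m]≡n v≤) (P⇒cold (Equivalence.from (same (X ∸ u) (Y ∸ v)) P))) ≢m

  -- Letters A and partners lie beyond ℓ, so these rows hold only terminal cold positions.
  cold-below : ∀ {p q} → q ≤ ℓ → Cold p q → p ≤ ℓ
  cold-below _ (terminal le)       = ≤-trans (m≤m+n _ _) le
  cold-below {x} q≤ (lower _ refl) = contradiction q≤ (<⇒≱ (ℓ<partner x))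
  cold-below q≤ (upper aq _)       = contradiction q≤ (<⇒≱ (A⇒ℓ< aq))

  A-suc-ℓ : At A (suc ℓ)
  A-suc-ℓ = subst (At A) (trans (+-identityʳ (gap 0)) gap-zero) (partner-T (initial-T z≤n))

  -- Row `L` is the first beyond the terminal ones, and its letter A leaves `partner L` = 2(ℓ+1) as
  -- its only cold entry. Other moves end in rows up to ℓ, where cold entries have first coordinate
  -- at most ℓ.
  horizontal-win : ∀ i → UniqueWin (suc i) 0
  horizontal-win i = record
    { x = partner L ; y = L ; move = horiz i ; cold = upper A-suc-ℓ refl
    ; ℓ< = m≤n+m L (suc i + partner L)
    ; unique = unique }
    where
    L : ℕ
    L = suc ℓ
    unique : ∀ {u v p q} → Wythoff u v → u + p ≡ suc i + partner L → v + q ≡ L →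
      Cold p q → u ≡ suc i × v ≡ 0
    unique (horiz k) ep refl (terminal le) = contradiction (≤-trans (m≤n+m L _) le) (<⇒≱ ≤-refl)
    unique (horiz k) ep refl (lower ap L≡) = ⊥-elim (A≢B (subst (At A) L≡ A-suc-ℓ) (partner-A ap))
    unique (horiz k) ep refl (upper _ refl) = +-cancelʳ-≡ (partner L) (suc k) (suc i) ep , refl
    unique (vert k) refl eq c =
      contradiction (cold-below (s≤s⁻¹ (suc+⇒< eq)) c)
                    (<⇒≱ (<-≤-trans (ℓ<partner L) (m≤n+m (partner L) (suc i))))
    -- Such a move takes at most `L` and would end in a column below `gap L`, so it would have to
    -- start left of `partner L`.
    unique {p = p} (diag k) ep eq c = contradiction ep (<⇒≢ (begin-strict
      suc k + p         ≤⟨ +-monoˡ-≤ p (m+n≤o⇒m≤o (suc k) (≤-reflexive eq)) ⟩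
      L + p             <⟨ +-monoʳ-< L (≤-<-trans (cold-below (s≤s⁻¹ (suc+⇒< eq)) c) (ℓ<gap L)) ⟩
      L + gap L         ≡⟨ +-comm L (gap L) ⟩
      partner L         ≤⟨ m≤n+m (partner L) (suc i) ⟩
      suc i + partner L ∎))
      where open ≤-Reasoning

  -- With A at both coordinates, the cold entry of the row lies too far right and that of the column
  -- not below; the diagonal holds only the target.
  diagonal-win : ∀ i → UniqueWin (suc i) (suc i)
  diagonal-win i with diagonal-witness i
  ... | n , an , ax , ay = record
    { x = n ; y = partner n ; move = diag i ; cold = lower an refl
    ; ℓ< = ≤-trans (A⇒ℓ< ax) (m≤m+n _ _)
    ; unique = unique }
    where
    -- Translation keeps the difference at `gap n`, while the gap of the new column is at least
    -- that.
    y≤ : suc i + partner n ≤ partner (suc i + n)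
    y≤ = begin
      suc i + (gap n + n)           ≡⟨ +-assoc (suc i) (gap n) n ⟨
      suc i + gap n + n             ≡⟨ cong (_+ n) (+-comm (suc i) (gap n)) ⟩
      gap n + suc i + n             ≡⟨ +-assoc (gap n) (suc i) n ⟩
      gap n + (suc i + n)           ≤⟨ +-monoˡ-≤ (suc i + n) (gap-mono-+ (suc i) n) ⟩
      gap (suc i + n) + (suc i + n) ∎
      where open ≤-Reasoning
    unique : ∀ {u v p q} → Wythoff u v → u + p ≡ suc i + n → v + q ≡ suc i + partner n →
      Cold p q → u ≡ suc i × v ≡ suc i
    unique (horiz k) ep refl (terminal le) = contradiction (≤-trans (m≤n+m _ _) le) (<⇒≱ (A⇒ℓ< ay))
    unique (horiz k) ep refl (lower ap q≡) = ⊥-elim (A≢B (subst (At A) q≡ ay) (partner-A ap))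
    unique (horiz k) ep refl (upper aq p≡) = contradiction p≡
      (<⇒≢ (<-trans (suc+⇒< ep) (≤-<-trans (+-monoʳ-≤ (suc i) (m≤n+m n (gap n))) (n<partner _))))
    unique (vert k) refl eq (terminal le) = contradiction (≤-trans (m≤m+n _ _) le) (<⇒≱ (A⇒ℓ< ax))
    unique (vert k) refl eq (lower ap q≡) = contradiction q≡ (<⇒≢ (<-≤-trans (suc+⇒< eq) y≤))
    unique (vert k) refl eq (upper aq p≡) = ⊥-elim (A≢B (subst (At A) p≡ ax) (partner-A aq))
    unique (diag k) ep eq c
      with refl ← cold-on-diagonal an (diagonal-difference {suc i} (gap n) refl refl ep eq) c =
      let k≡i = +-cancelʳ-≡ n (suc k) (suc i) ep in k≡i , k≡i

theorem30 : ∀ (ℓ : ℕ) → 1 ≤ ℓ → ℓ ≤ 4 →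
    ∀ (a b : ℕ) → Wythoff a b →
    ¬ (∀ (x y : ℕ) → IsP Wythoff ℓ x y ⇔ IsP (WythoffWithout a b) ℓ x y)
theorem30 ℓ _ _ _ _ (horiz i) = uniqueWin⇒essential ℓ (horizontal-win ℓ i)
theorem30 ℓ _ _ _ _ (vert i)  = uniqueWin⇒essential ℓ (uniqueWin-sym ℓ (horizontal-win ℓ i))
theorem30 ℓ _ _ _ _ (diag i)  = uniqueWin⇒essential ℓ (diagonal-win ℓ i)
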